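{- Let $n\ge 1$, let $\pi\in\mathcal{S}_n$ and let $\Lambda=\Lambda(\pi)$ be its associated partition. Then (i) the number of different nonzero parts of $\Lambda$ equals $\mathrm{des}(\pi)$; (ii) the number of nonzero parts of $\Lambda$ equals $n-\mathrm{lrmax}(\pi)$; (iii) the largest part of $\Lambda$ equals the largest descent of $\pi$; (iv) the sum of all different parts of $\Lambda$ (each distinct value counted once) equals $\mathrm{maj}(\pi)$; (v) the sum of all parts (equivalently, the area) of $\Lambda$ equals $\mathrm{lbsum}(\pi)$.
   Context: $\mathcal{S}_n$ is the set of permutations $\pi=\pi_1\cdots\pi_n$ of $[n]=\{1,\ldots,n\}$, written as words. The standardization $w^{\ast}$ of a word $w$ of $m$ distinct positive integers is the permutation in $\mathcal{S}_m$ obtained by replacing the $i$th smallest letter by $i$. The map $D$ from permutations in $\mathcal{S}_n$ to Dyck words of length $2n$ in the letters $\mathsf{u}$ (up step $(0,1)$) and $\mathsf{r}$ (right step $(1,0)$) is defined recursively by $D(\emptyset)=\emptyset$ and, for $\pi=\pi_L\,n\,\pi_R\in\mathcal{S}_n$ with $n\ge1$ ($\pi_L,\pi_R$ the possibly empty words to the left and right of the letter $n$), $D(\pi)=\mathsf{u}\,D(\pi_L^{\ast})\,\mathsf{r}\,D(\pi_R^{\ast})$. $\Lambda(\pi)$ is the partition with exactly $n-1$ parts (parts equal to $0$ allowed) whose Young diagram is the region above the path $D(\pi)$ drawn from $(0,0)$ to $(n,n)$. Equivalently, the parts of $\Lambda(\pi)$ are, in weakly decreasing order, the numbers of letters $\mathsf{r}$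 preceding the 2nd, 3rd, ..., $n$th letter $\mathsf{u}$ in $D(\pi)$. A descent of $\pi$ is an index $i\in[n-1]$ with $\pi_i>\pi_{i+1}$; $\mathrm{des}(\pi)$ is the number of descents and $\mathrm{maj}(\pi)$ is the sum of all descents. $\mathrm{lrmax}(\pi)$ is the number of left-to-right maxima, i.e. elements $\pi_i$ greater than all elements to their left. The left border number $a_i$ of $\pi$ is the largest position $m<i$ with $\pi_m>\pi_i$, or $0$ if no such position exists, and $\mathrm{lbsum}(\pi)=a_1+\cdots+a_n$. By convention the largest descent of a permutation without descents is $0$, and the largest part of an empty partition is $0$. -}

module Defs where

open import Data.Nat using (ℕ; zero; suc; _+_; _∸_; _≤_; _<?_; _≤?_; _≟_; s≤s⁻¹)
open import Data.Nat.Properties using (≤-refl; ≤-trans; ≤-reflexive; m≤m+n; m≤n+m; nonZero?; +-suc)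
open import Data.List.Base using (List; []; _∷_; _++_; length; map; filter; break; drop; reverse; deduplicate; applyUpTo)
open import Data.List.Properties using (length-++; length-map; length-filter; length-applyUpTo; span-defn; takeWhile++dropWhile)
open import Data.Nat.ListAction using (sum)
open import Data.List.Extrema.Nat using (max)
open import Data.List.Membership.Propositional using (_∉_)
open import Data.List.Relation.Unary.All using (all?)
open import Data.List.Relation.Unary.Any using (here; there)
open import Data.List.Relation.Binary.Permutation.Propositional using (_↭_)
open import Data.Product.Base using (_×_; _,_; proj₁; proj₂; uncurry)
open import Function.Base using (_∘_)
open import Relation.Nullary.Decidable using (¬?; dec-true; dec-false)
open import Relation.Binary.PropositionalEquality using (_≡_; refl; sym; trans; cong; cong₂; subst)

Word : Set
Word = List ℕ

[1⋯_] : ℕ → List ℕ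
[1⋯ n ] = applyUpTo suc n

infix 4 _∈𝒮_

_∈𝒮_ : Word → ℕ → Set
π ∈𝒮 n = π ↭ [1⋯ n ]

-- Positions are numbered from 1.  The value 0 at a position outside
-- 1, …, length π is never consulted by the statistics below.
letter : Word → ℕ → ℕ
letter []      _             = 0
letter (x ∷ π) 0             = 0
letter (x ∷ π) 1             = x
letter (x ∷ π) (suc (suc i)) = letter π (suc i)

-- In a word of distinct letters, the ith smallest letter is the letter x
-- such that exactly i letters are ≤ x.
standardize : Word → Word
standardize w = map (λ x → length (filter (_≤? x) w)) w

data Step : Set where
  u r : Step

-- The first argument bounds the recursion depth; D supplies the length of
-- π, which suffices by D-step.  A permutation of [1⋯ n ] is split at its
-- letter n = length π, so the case where that letter is absent is only
-- reached by the empty permutation (or by words that are not permutations).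
D-bounded : ℕ → Word → List Step
D-bounded zero    π = []
D-bounded (suc k) π with break (_≟ length π) π
... | πL , []     = []
... | πL , _ ∷ πR = u ∷ D-bounded k (standardize πL) ++ r ∷ D-bounded k (standardize πR)

D : Word → List Step
D π = D-bounded (length π) π

rsBeforeEachU : ℕ → List Step → List ℕ
rsBeforeEachU c []      = []
rsBeforeEachU c (u ∷ w) = c ∷ rsBeforeEachU c w
rsBeforeEachU c (r ∷ w) = rsBeforeEachU (suc c) w

-- The row of the diagram at the height of an up step has as many cells as
-- there are right steps before that up step.  The bottom row, which is
-- always empty, is not counted as a part; `reverse` lists the remaining
-- n − 1 parts in weakly decreasing order.
Λ : Word → List ℕ
Λ π = reverse (drop 1 (rsBeforeEachU 0 (D π)))

nonzeroParts : List ℕ → List ℕ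
nonzeroParts = filter nonZero?

differentParts : List ℕ → List ℕ
differentParts = deduplicate _≟_

-- The base value 0 of `max` realises the conventions for a permutation
-- without descents and for a partition without parts.
largest : List ℕ → ℕ
largest = max 0

descents : Word → List ℕ
descents π = filter (λ i → letter π (suc i) <? letter π i) [1⋯ length π ∸ 1 ]

des : Word → ℕ
des π = length (descents π)

maj : Word → ℕ
maj π = sum (descents π)

lrmax : Word → ℕ
lrmax π = length (filter (λ i → all? (λ m → letter π m <? letter π i) [1⋯ i ∸ 1 ]) [1⋯ length π ])

leftBorder : Word → ℕ → ℕ
leftBorder π i = max 0 (filter (λ m → letter π i <? letter π m) [1⋯ i ∸ 1 ])

lbsum : Word → ℕ
lbsum π = sum (map (leftBorder π) [1⋯ length π ])

-- The truncated subtraction n ∸ lrmax π is exact for π ∈𝒮 n.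
lrmax≤length : ∀ π → lrmax π ≤ length π
lrmax≤length π = ≤-trans (length-filter _ [1⋯ length π ])
                         (≤-reflexive (length-applyUpTo suc (length π)))

private

  break-++ : ∀ n π {πL πR} → break (_≟ n) π ≡ (πL , πR) → π ≡ πL ++ πR
  break-++ n π eq =
    trans (sym (takeWhile++dropWhile P? π))
          (cong (uncurry _++_) (trans (sym (span-defn P? π)) eq))
    where P? = ¬? ∘ (_≟ n)

  break-at : ∀ n πL πR → n ∉ πL → break (_≟ n) (πL ++ n ∷ πR) ≡ (πL , n ∷ πR)
  break-at n [] πR n∉ rewrite dec-true (n ≟ n) refl = refl
  break-at n (x ∷ πL) πR n∉
    rewrite dec-false (x ≟ n) (n∉ ∘ here ∘ sym) | break-at n πL πR (n∉ ∘ there) = refl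

  split-≤ : ∀ πL {x} πR {k} → length (πL ++ x ∷ πR) ≤ suc k →
            length (standardize πL) ≤ k × length (standardize πR) ≤ k
  split-≤ πL πR {k} le =
    ≤-trans (≤-reflexive (length-map _ πL)) (≤-trans (m≤m+n (length πL) _) sum≤k) ,
    ≤-trans (≤-reflexive (length-map _ πR)) (≤-trans (m≤n+m _ (length πL)) sum≤k)
    where
    sum≤k : length πL + length πR ≤ k
    sum≤k = s≤s⁻¹ (subst (_≤ suc k) (trans (length-++ πL) (+-suc (length πL) (length πR))) le)

  bound-irrelevant : ∀ k k′ π → length π ≤ k → length π ≤ k′ → D-bounded k π ≡ D-bounded k′ π
  bound-irrelevant zero    zero     π  _ _ = refl
  bound-irrelevant zero    (suc k′) [] _ _ = refl
  bound-irrelevant (suc k) zero     [] _ _ = refl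
  bound-irrelevant (suc k) (suc k′) π p q with break (_≟ length π) π in eq
  ... | πL , []     = refl
  ... | πL , x ∷ πR
    with p′ ← split-≤ πL πR (subst (λ v → length v ≤ suc k) (break-++ _ π eq) p)
       | q′ ← split-≤ πL πR (subst (λ v → length v ≤ suc k′) (break-++ _ π eq) q)
    = cong₂ (λ a b → u ∷ a ++ r ∷ b)
        (bound-irrelevant k k′ _ (proj₁ p′) (proj₁ q′))
        (bound-irrelevant k k′ _ (proj₂ p′) (proj₂ q′))

-- The recursive equation defining D.
D-step : ∀ n πL πR → length (πL ++ n ∷ πR) ≡ n → n ∉ πL →
         D (πL ++ n ∷ πR) ≡ u ∷ D (standardize πL) ++ r ∷ D (standardize πR)
D-step zero πL πR len n∉ with () ← trans (sym (trans (length-++ πL) (+-suc (length πL) _))) len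
D-step n@(suc k) πL πR len n∉
  with l≤ , r≤ ← split-≤ πL πR (≤-reflexive len)
  rewrite len | len | break-at n πL πR n∉
  = cong₂ (λ a b → u ∷ a ++ r ∷ b)
      (bound-irrelevant k _ _ l≤ ≤-refl)
      (bound-irrelevant k _ _ r≤ ≤-refl)

{-# OPTIONS --safe #-}

-- The left border numbers a₁, …, aₙ satisfy the same recursion as the right
-- steps preceding the up steps of D(π): for π = L n R they are those of L,
-- then a 0 for the letter n, then those of R shifted by |L| + 1, and they
-- depend only on the relative order of the letters.  Hence 0 ∷ Λ(π) is a
-- rearrangement of a₁, …, aₙ.  The nonzero values among the aᵢ are exactly
-- the descents of π, and aᵢ = 0 exactly when πᵢ is a left-to-right maximum,
-- so all five equalities can be read off from the aᵢ.

module Submission where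

open import Defs
open import Data.Nat using
  (ℕ; zero; suc; _+_; _∸_; _≥_; _≤_; _<_; _<?_; _≤?_; _≟_; NonZero; z≤n; s≤s; s≤s⁻¹)
open import Data.Nat.Properties using
  (≤-refl; ≤-trans; ≤-reflexive; ≤-antisym; n≤1+n; <⇒≤; <⇒≱; <⇒≢; <-irrefl; ≮⇒≥; ≤⇒≯;
   <⇒≤pred; <-cmp; ≤∧≢⇒<; m≤m+n; m≤n+m; m+n∸n≡m; +-suc; +-comm; +-assoc; +-identityʳ;
   suc-injective; nonZero?)
open import Data.Nat.ListAction using (sum)
open import Data.Nat.ListAction.Properties using (sum-↭)
open import Data.List.Base using
  (List; []; _∷_; [_]; _++_; _∷ʳ_; _ʳ++_; length; map; filter; drop; reverse; applyUpTo)
open import Data.List.Extrema.Nat using (max; argmax-sel; max≤v⁺; max≈v⁺; xs≤max)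
open import Data.List.Membership.Propositional using (_∈_; lose)
open import Data.List.Membership.Propositional.Properties using
  (∈-∃++; ∈-++⁺ʳ; ∈-map⁺; ∈-map⁻; ∈-filter⁺; ∈-filter⁻; ∈-applyUpTo⁺; ∈-applyUpTo⁻;
   ∈-deduplicate⁺; ∈-deduplicate⁻)
open import Data.List.Membership.Propositional.Properties.WithK using (unique∧set⇒bag)
open import Data.List.Properties using
  (length-map; length-++; length-filter; length-applyUpTo; applyUpTo-∷ʳ; map-cong; map-++;
   map-∘; map-id; filter-++; filter-accept; filter-reject; filter-some; filter-notAll;
   ++-identityʳ)
open import Data.List.Relation.Binary.BagAndSetEquality using (∼bag⇒↭)
open import Data.List.Relation.Binary.Permutation.Propositional using
  (_↭_; ↭-refl; ↭-sym; ↭-trans; ↭-prep; ↭⇒↭ₛ; module PermutationReasoning)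
open import Data.List.Relation.Binary.Permutation.Propositional.Properties using
  (↭-length; ↭-reverse; ∈-resp-↭; All-resp-↭; filter-↭; shift; drop-mid)
  renaming (++⁺ to ↭-++⁺)
open import Data.List.Relation.Binary.Permutation.Setoid.Properties using (Unique-resp-↭)
open import Data.List.Relation.Binary.Subset.Propositional using (_⊆_)
open import Data.List.Relation.Unary.All as All using (All; []; _∷_; all?)
import Data.List.Relation.Unary.All.Properties as All
open import Data.List.Relation.Unary.AllPairs using (AllPairs; []; _∷_)
open import Data.List.Relation.Unary.Any using (here; there)
open import Data.List.Relation.Unary.Unique.DecPropositional.Properties _≟_ using
  (deduplicate-!)
open import Data.List.Relation.Unary.Unique.Propositional using (Unique)
open import Data.List.Relation.Unary.Unique.Propositional.Properties using
  (applyUpTo⁺₁; filter⁺)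
open import Data.Product.Base using (_×_; _,_; proj₁; proj₂)
open import Data.Sum.Base using (inj₁; inj₂)
open import Function.Base using (_∘_; id)
open import Function.Bundles using (mk⇔)
open import Level using (Level)
open import Relation.Binary.Core using (Rel)
open import Relation.Binary.Definitions using (tri<; tri≈; tri>)
open import Relation.Binary.PropositionalEquality using
  (_≡_; _≢_; refl; sym; trans; cong; cong₂; subst; setoid; module ≡-Reasoning)
open import Relation.Nullary using (¬_; yes; no; contradiction)
open import Relation.Unary using (Pred; Decidable)

-- Repetition-free lists, rearrangements and filters

private
  variable
    a b p q : Level
    A : Set a
    B : Set b

AllPairs-++⁻ : {R : Rel A p} (xs : List A) {ys : List A} →
               AllPairs R (xs ++ ys) → AllPairs R xs × AllPairs R ys
AllPairs-++⁻ []       rs       = [] , rs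
AllPairs-++⁻ (x ∷ xs) (x∼ ∷ rs) with ls , ms ← AllPairs-++⁻ xs rs = All.++⁻ˡ xs x∼ ∷ ls , ms

-- Injectivity is asked of members only: `rank w` separates the letters of `w` but not arbitrary
-- numbers.
Unique-map⁺-∈ : {f : A → B} (xs : List A) →
                (∀ {x y} → x ∈ xs → y ∈ xs → f x ≡ f y → x ≡ y) →
                Unique xs → Unique (map f xs)
Unique-map⁺-∈ []       inj []         = []
Unique-map⁺-∈ (x ∷ xs) inj (x∉ ∷ xs!) =
  All.map⁺ (All.tabulate (λ y∈ fx≡fy → All.lookup x∉ y∈ (inj (here refl) (there y∈) fx≡fy)))
  ∷ Unique-map⁺-∈ xs (λ x∈ y∈ → inj (there x∈) (there y∈)) xs!

-- Pigeonhole principle: cut the head of `xs` out of `ys`. As it does not recur in `xs`, the tail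
-- embeds in what is left, and the length bound leaves nothing over at the end.
unique∧⊆⇒↭ : {xs ys : List A} → Unique xs → xs ⊆ ys → length ys ≤ length xs → xs ↭ ys
unique∧⊆⇒↭ {xs = []}     {[]}    _          _    _  = ↭-refl
unique∧⊆⇒↭ {xs = x ∷ xs}         (x∉ ∷ xs!) sub le
  with ls , rs , refl ← ∈-∃++ (sub (here refl)) =
  ↭-trans (↭-prep x (unique∧⊆⇒↭ xs! sub′ (s≤s⁻¹ (subst (_≤ _) (↭-length (shift x ls rs)) le))))
          (↭-sym (shift x ls rs))
  where
  sub′ : xs ⊆ ls ++ rs
  sub′ z∈ with ∈-resp-↭ (shift x ls rs) (sub (there z∈))
  ... | here refl = contradiction refl (All.lookup x∉ z∈)
  ... | there z∈′ = z∈′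

unique∧same-elements⇒↭ : {xs ys : List A} → Unique xs → Unique ys → xs ⊆ ys → ys ⊆ xs → xs ↭ ys
unique∧same-elements⇒↭ xs! ys! xs⊆ys ys⊆xs = ∼bag⇒↭ (unique∧set⇒bag xs! ys! (mk⇔ xs⊆ys ys⊆xs))

filter-filter-⊆ : {P : Pred A p} {Q : Pred A q} (P? : Decidable P) (Q? : Decidable Q) →
                  (∀ {x} → P x → Q x) → ∀ xs → filter P? (filter Q? xs) ≡ filter P? xs
filter-filter-⊆ P? Q? P⊆Q []       = refl
filter-filter-⊆ P? Q? P⊆Q (x ∷ xs) with Q? x
... | no ¬qx = trans (filter-filter-⊆ P? Q? P⊆Q xs) (sym (filter-reject P? (¬qx ∘ P⊆Q)))
... | yes _ with P? x
...   | yes _ = cong (x ∷_) (filter-filter-⊆ P? Q? P⊆Q xs)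
...   | no _  = filter-filter-⊆ P? Q? P⊆Q xs

-- One test looks at `f x` and the other at `x` itself, as is needed to weigh nonzero border numbers
-- against the positions of left-to-right maxima.
length-filter-complement :
  {P : Pred B p} {Q : Pred A q} (P? : Decidable P) (Q? : Decidable Q) (f : A → B) (xs : List A) →
  (∀ {x} → x ∈ xs → P (f x) → ¬ Q x) → (∀ {x} → x ∈ xs → ¬ P (f x) → Q x) →
  length (filter P? (map f xs)) + length (filter Q? xs) ≡ length xs
length-filter-complement P? Q? f []       P⇒¬Q ¬P⇒Q = refl
length-filter-complement P? Q? f (x ∷ xs) P⇒¬Q ¬P⇒Q
  with ih ← length-filter-complement P? Q? f xs (P⇒¬Q ∘ there) (¬P⇒Q ∘ there)
     | P? (f x) | Q? x
... | yes px | yes qx = contradiction qx (P⇒¬Q (here refl) px)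
... | yes _  | no _   = cong suc ih
... | no _   | yes _  = trans (+-suc _ _) (cong suc ih)
... | no ¬px | no ¬qx = contradiction (¬P⇒Q (here refl) ¬px) ¬qx

-- Permutations of an initial segment

∈-range⁺ : ∀ {k n} → 1 ≤ k → k ≤ n → k ∈ [1⋯ n ]
∈-range⁺ {suc k} _ k<n = ∈-applyUpTo⁺ suc k<n

∈-range⁻ : ∀ {k n} → k ∈ [1⋯ n ] → 1 ≤ k × k ≤ n
∈-range⁻ k∈ with _ , i<n , refl ← ∈-applyUpTo⁻ suc k∈ = s≤s z≤n , i<n

range-! : ∀ n → Unique [1⋯ n ]
range-! n = applyUpTo⁺₁ suc n (λ i<j _ → <⇒≢ i<j ∘ suc-injective)

Unique-𝒮 : ∀ {n π} → π ∈𝒮 n → Unique π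
Unique-𝒮 {n} π∈ = Unique-resp-↭ (setoid ℕ) (↭⇒↭ₛ (↭-sym π∈)) (range-! n)

length-𝒮 : ∀ {n π} → π ∈𝒮 n → length π ≡ n
length-𝒮 {n} π∈ = trans (↭-length π∈) (length-applyUpTo suc n)

-- Standardization

rank : Word → ℕ → ℕ
rank w x = length (filter (_≤? x) w)

rank-mono-≤ : ∀ w {x y} → x ≤ y → rank w x ≤ rank w y
rank-mono-≤ w {x} {y} x≤y =
  subst (_≤ rank w y) (cong length (filter-filter-⊆ (_≤? x) (_≤? y) (λ z≤x → ≤-trans z≤x x≤y) w))
        (length-filter (_≤? x) (filter (_≤? y) w))

-- The letter `y` is counted by its own rank but not by that of `x`, so the inclusion of counted
-- letters is strict.
rank-mono-< : ∀ w {x y} → y ∈ w → x < y → rank w x < rank w y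
rank-mono-< w {x} {y} y∈w x<y =
  subst (_< rank w y)
        (cong length (filter-filter-⊆ (_≤? x) (_≤? y) (λ z≤x → ≤-trans z≤x (<⇒≤ x<y)) w))
        (filter-notAll (_≤? x) (filter (_≤? y) w)
          (lose (∈-filter⁺ (_≤? y) y∈w ≤-refl) (<⇒≱ x<y)))

rank-injective : ∀ w {x y} → x ∈ w → y ∈ w → rank w x ≡ rank w y → x ≡ y
rank-injective w {x} {y} x∈ y∈ eq with <-cmp x y
... | tri< x<y _ _ = contradiction eq (<⇒≢ (rank-mono-< w y∈ x<y))
... | tri≈ _ x≡y _ = x≡y
... | tri> _ _ y<x = contradiction (sym eq) (<⇒≢ (rank-mono-< w x∈ y<x))

-- Ranks of distinct letters are distinct and lie between 1 and the length, the lower bound because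
-- each letter counts itself; by pigeonhole they exhaust the range.
standardize-∈𝒮 : ∀ {w} → Unique w → standardize w ∈𝒮 length w
standardize-∈𝒮 {w} w! =
  unique∧⊆⇒↭ (Unique-map⁺-∈ w (rank-injective w) w!) in-range
    (≤-reflexive (trans (length-applyUpTo suc (length w)) (sym (length-map _ w))))
  where
  in-range : standardize w ⊆ [1⋯ length w ]
  in-range z∈ with x , x∈ , refl ← ∈-map⁻ (rank w) z∈ =
    ∈-range⁺ (filter-some (_≤? x) (lose x∈ ≤-refl)) (length-filter (_≤? x) w)

-- Left border numbers

-- The prefix is stored in reverse, so that its head is the nearest letter on the left.
lastGreater : ℕ → List ℕ → ℕ
lastGreater x []      = 0
lastGreater x (y ∷ p) with x <? y
... | yes _ = suc (length p)
... | no  _ = lastGreater x p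

-- Carrying the prefix instead of positions lets concatenation and relabelling be handled by
-- structural recursion; with the empty prefix this is a₁, ..., aₙ.
borders : List ℕ → Word → List ℕ
borders p []      = []
borders p (x ∷ w) = lastGreater x p ∷ borders (x ∷ p) w

letter-ʳ++ : ∀ p w i → letter (p ʳ++ w) (suc (length p + i)) ≡ letter w (suc i)
letter-ʳ++ []      w i = refl
letter-ʳ++ (x ∷ p) w i = begin
  letter (p ʳ++ x ∷ w) (suc (suc (length p + i)))  ≡⟨ cong (letter (p ʳ++ x ∷ w) ∘ suc) (sym (+-suc (length p) i)) ⟩
  letter (p ʳ++ x ∷ w) (suc (length p + suc i))    ≡⟨ letter-ʳ++ p (x ∷ w) (suc i) ⟩
  letter w (suc i)                                 ∎
  where open ≡-Reasoning

-- If the nearest letter `y` is greater than `x`, its position is the last in range and hence the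
-- maximum; otherwise `y` contributes nothing and moves into `w`. The suffix is arbitrary so that
-- the whole word stays fixed during this recursion.
max-greater≡lastGreater : ∀ x p w →
  max 0 (filter (λ m → x <? letter (p ʳ++ w) m) [1⋯ length p ]) ≡ lastGreater x p
max-greater≡lastGreater x []      w = refl
max-greater≡lastGreater x (y ∷ p) w = begin
  max 0 (filter G? [1⋯ suc k ])                ≡⟨ cong (max 0 ∘ filter G?) (sym (applyUpTo-∷ʳ suc k)) ⟩
  max 0 (filter G? ([1⋯ k ] ∷ʳ suc k))         ≡⟨ cong (max 0) (filter-++ G? [1⋯ k ] _) ⟩
  max 0 (filter G? [1⋯ k ] ++ filter G? [ suc k ]) ≡⟨ last-letter ⟩
  lastGreater x (y ∷ p)                        ∎
  where
  open ≡-Reasoning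
  k = length p
  π = p ʳ++ y ∷ w
  G? = λ m → x <? letter π m
  letter≡y : letter π (suc k) ≡ y
  letter≡y = trans (cong (letter π ∘ suc) (sym (+-identityʳ k))) (letter-ʳ++ p (y ∷ w) 0)
  last-letter : max 0 (filter G? [1⋯ k ] ++ filter G? [ suc k ]) ≡ lastGreater x (y ∷ p)
  last-letter with x <? y
  ... | yes x<y = trans
    (cong (λ l → max 0 (filter G? [1⋯ k ] ++ l)) (filter-accept G? (subst (x <_) (sym letter≡y) x<y)))
    (max≈v⁺ (∈-++⁺ʳ (filter G? [1⋯ k ]) (here refl))
            (All.++⁺ (All.filter⁺ G? (All.applyUpTo⁺₁ suc k (λ i<k → ≤-trans i<k (n≤1+n k))))
                     (≤-refl ∷ []))
            z≤n)
  ... | no x≮y = trans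
    (cong (λ l → max 0 (filter G? [1⋯ k ] ++ l)) (filter-reject G? (x≮y ∘ subst (x <_) letter≡y)))
    (trans (cong (max 0) (++-identityʳ (filter G? [1⋯ k ]))) (max-greater≡lastGreater x p (y ∷ w)))

leftBorder≡lastGreater : ∀ p x w → leftBorder (p ʳ++ x ∷ w) (suc (length p)) ≡ lastGreater x p
leftBorder≡lastGreater p x w =
  trans (cong (λ z → max 0 (filter (λ m → z <? letter (p ʳ++ x ∷ w) m) [1⋯ length p ]))
              (trans (cong (letter (p ʳ++ x ∷ w) ∘ suc) (sym (+-identityʳ (length p))))
                     (letter-ʳ++ p (x ∷ w) 0)))
        (max-greater≡lastGreater x p (x ∷ w))

-- The index function is general because `applyUpTo` replaces it by `f ∘ suc` at each letter; the
-- hypothesis records that it enumerates the positions after the prefix.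
map-leftBorder≡borders : ∀ p w (f : ℕ → ℕ) → (∀ i → f i ≡ suc (length p + i)) →
  map (leftBorder (p ʳ++ w)) (applyUpTo f (length w)) ≡ borders p w
map-leftBorder≡borders p []      f f≡ = refl
map-leftBorder≡borders p (x ∷ w) f f≡ = cong₂ _∷_
  (trans (cong (leftBorder (p ʳ++ x ∷ w)) (trans (f≡ 0) (cong suc (+-identityʳ (length p)))))
         (leftBorder≡lastGreater p x w))
  (map-leftBorder≡borders (x ∷ p) w (f ∘ suc) (λ i → trans (f≡ (suc i)) (cong suc (+-suc (length p) i))))

leftBorders≡borders : ∀ π → map (leftBorder π) [1⋯ length π ] ≡ borders [] π
leftBorders≡borders π = map-leftBorder≡borders [] π suc (λ _ → refl)

borders-++ : ∀ p v w → borders p (v ++ w) ≡ borders p v ++ borders (v ʳ++ p) w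
borders-++ p []      w = refl
borders-++ p (x ∷ v) w = cong (lastGreater x p ∷_) (borders-++ (x ∷ p) v w)

lastGreater-upper-bound : ∀ {x p} → All (_< x) p → lastGreater x p ≡ 0
lastGreater-upper-bound []                              = refl
lastGreater-upper-bound {x} {y ∷ _} (y<x ∷ p<x) with x <? y
... | yes x<y = contradiction x<y (≤⇒≯ (<⇒≤ y<x))
... | no _    = lastGreater-upper-bound p<x

-- The prefix is reversed, so `q` lies to the left of `N` and `p` between `N` and `x`. The search
-- never passes `N`, at position |q| + 1: a hit in `p` is displaced by that amount, and a miss,
-- worth 0, becomes `N` itself.
lastGreater-++-∷ : ∀ {x N} p q → x < N → lastGreater x (p ++ N ∷ q) ≡ suc (length q) + lastGreater x p
lastGreater-++-∷ {x} {N} [] q x<N with x <? N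
... | yes _   = cong suc (sym (+-identityʳ (length q)))
... | no x≮N  = contradiction x<N x≮N
lastGreater-++-∷ {x} {N} (y ∷ p) q x<N with x <? y
... | no _  = lastGreater-++-∷ p q x<N
... | yes _ = begin
  suc (length (p ++ N ∷ q))        ≡⟨ cong suc (length-++ p) ⟩
  suc (length p + suc (length q))  ≡⟨ cong suc (+-comm (length p) _) ⟩
  suc (suc (length q) + length p)  ≡⟨ sym (+-suc (suc (length q)) (length p)) ⟩
  suc (length q) + suc (length p)  ∎
  where open ≡-Reasoning

borders-after-maximum : ∀ {N} p q w → All (_< N) w →
  borders (p ++ N ∷ q) w ≡ map (suc (length q) +_) (borders p w)
borders-after-maximum p q []      []          = refl
borders-after-maximum p q (x ∷ w) (x<N ∷ w<N) =
  cong₂ _∷_ (lastGreater-++-∷ p q x<N) (borders-after-maximum (x ∷ p) q w w<N)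

-- `N` has no greater letter before it, and it screens off `L` from every letter of `R`.
borders-split : ∀ {N} L R → All (_< N) L → All (_< N) R →
  borders [] (L ++ N ∷ R) ≡ borders [] L ++ 0 ∷ map (suc (length L) +_) (borders [] R)
borders-split {N} L R L<N R<N = begin
  borders [] (L ++ N ∷ R)
    ≡⟨ borders-++ [] L (N ∷ R) ⟩
  borders [] L ++ lastGreater N (reverse L) ∷ borders (N ∷ reverse L) R
    ≡⟨ cong (borders [] L ++_) (cong₂ _∷_
         (lastGreater-upper-bound (All-resp-↭ (↭-sym (↭-reverse L)) L<N))
         (borders-after-maximum [] (reverse L) R R<N)) ⟩
  borders [] L ++ 0 ∷ map (suc (length (reverse L)) +_) (borders [] R)
    ≡⟨ cong (λ l → borders [] L ++ 0 ∷ map (suc l +_) (borders [] R)) (↭-length (↭-reverse L)) ⟩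
  borders [] L ++ 0 ∷ map (suc (length L) +_) (borders [] R) ∎
  where open ≡-Reasoning

lastGreater-map : ∀ f {x} p → (∀ {y} → y ∈ p → x < y → f x < f y) → (∀ {y} → y ≤ x → f y ≤ f x) →
  lastGreater (f x) (map f p) ≡ lastGreater x p
lastGreater-map f []          mono-< mono-≤ = refl
lastGreater-map f {x} (y ∷ p) mono-< mono-≤ with x <? y | f x <? f y
... | yes _   | yes _     = cong suc (length-map f p)
... | yes x<y | no fx≮fy  = contradiction (mono-< (here refl) x<y) fx≮fy
... | no x≮y  | yes fx<fy = contradiction fx<fy (≤⇒≯ (mono-≤ (≮⇒≥ x≮y)))
... | no _    | no _      = lastGreater-map f p (mono-< ∘ there) mono-≤

-- Border numbers depend only on comparisons. The hypotheses are shaped for ranks, whose strict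
-- increase is guaranteed only when the larger argument is a letter of the word.
borders-map : ∀ f p w →
  (∀ {x y} → y ∈ w ʳ++ p → x < y → f x < f y) → (∀ {x y} → y ≤ x → f y ≤ f x) →
  borders (map f p) (map f w) ≡ borders p w
borders-map f p []      mono-< mono-≤ = refl
borders-map f p (x ∷ w) mono-< mono-≤ = cong₂ _∷_
  (lastGreater-map f p (λ y∈ → mono-< (∈-ʳ++⁺ʳ w (there y∈))) mono-≤)
  (borders-map f (x ∷ p) w mono-< mono-≤)
  where
  ∈-ʳ++⁺ʳ : ∀ v {q} {y : ℕ} → y ∈ q → y ∈ v ʳ++ q
  ∈-ʳ++⁺ʳ []      y∈ = y∈
  ∈-ʳ++⁺ʳ (z ∷ v) y∈ = ∈-ʳ++⁺ʳ v (there y∈)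

borders-standardize : ∀ w → borders [] (standardize w) ≡ borders [] w
borders-standardize w = borders-map (rank w) [] w
  (λ y∈ → rank-mono-< w (∈-resp-↭ (↭-reverse w) y∈)) (rank-mono-≤ w)

-- The Dyck word

countR : List Step → ℕ
countR []      = 0
countR (u ∷ w) = countR w
countR (r ∷ w) = suc (countR w)

countR-++ : ∀ v w → countR (v ++ w) ≡ countR v + countR w
countR-++ []      w = refl
countR-++ (u ∷ v) w = countR-++ v w
countR-++ (r ∷ v) w = cong suc (countR-++ v w)

rsBeforeEachU-++ : ∀ c v w → rsBeforeEachU c (v ++ w) ≡ rsBeforeEachU c v ++ rsBeforeEachU (c + countR v) w
rsBeforeEachU-++ c []      w = cong (λ d → rsBeforeEachU d w) (sym (+-identityʳ c))
rsBeforeEachU-++ c (u ∷ v) w = cong (c ∷_) (rsBeforeEachU-++ c v w)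
rsBeforeEachU-++ c (r ∷ v) w =
  trans (rsBeforeEachU-++ (suc c) v w)
        (cong (λ d → rsBeforeEachU (suc c) v ++ rsBeforeEachU d w) (sym (+-suc c (countR v))))

record MaximumSplit (n : ℕ) (π : Word) : Set where
  field
    L R      : Word
    π≡       : π ≡ L ++ suc n ∷ R
    L<       : All (_< suc n) L
    R<       : All (_< suc n) R
    L!       : Unique L
    R!       : Unique R
    lengths  : length L + length R ≡ n

maximumSplit : ∀ {n π} → π ∈𝒮 suc n → MaximumSplit n π
maximumSplit {n} {π} π∈
  with L , R , refl ← ∈-∃++ (∈-resp-↭ (↭-sym π∈) (∈-range⁺ (s≤s z≤n) ≤-refl)) =
  record
    { π≡ = refl
    ; L< = All.++⁻ˡ L LR< ; R< = All.++⁻ʳ L LR<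
    ; L! = proj₁ LR! ; R! = proj₂ LR!
    ; lengths = trans (sym (length-++ L)) (length-𝒮 LR∈) }
  where
  LR∈ : (L ++ R) ∈𝒮 n
  -- With the range written as `[1⋯ n ]` followed by `suc n`, the letter `suc n` can be cancelled on
  -- both sides.
  LR∈ = subst (L ++ R ↭_) (++-identityʳ [1⋯ n ])
          (drop-mid L [1⋯ n ] (subst (L ++ suc n ∷ R ↭_) (sym (applyUpTo-∷ʳ suc n)) π∈))
  LR< : All (_< suc n) (L ++ R)
  LR< = All-resp-↭ (↭-sym LR∈) (All.applyUpTo⁺₁ suc n s≤s)
  LR! = AllPairs-++⁻ L (Unique-𝒮 LR∈)

module _ {n π} (s : MaximumSplit n π) where
  open MaximumSplit s

  D-split : D π ≡ u ∷ D (standardize L) ++ r ∷ D (standardize R)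
  D-split = trans (cong D π≡) (D-step (suc n) L R
    (trans (length-++ L) (trans (+-suc (length L) (length R)) (cong suc lengths)))
    (λ n∈ → <-irrefl refl (All.lookup L< n∈)))

-- The recursion descends to standardized halves, which are not subwords of π, hence the induction
-- on a bound `k` for the length. The offset `c` is general because the up steps of the right half
-- come after |L| + 1 further right steps; the `countR` component supplies the |L|.
D-borders : ∀ k n → n ≤ k → ∀ {π} → π ∈𝒮 n →
  countR (D π) ≡ n × (∀ c → rsBeforeEachU c (D π) ↭ map (c +_) (borders [] π))
D-borders k zero _ {[]} π∈ = refl , λ _ → ↭-refl
D-borders k zero _ {_ ∷ _} π∈ = contradiction (length-𝒮 π∈) λ ()
D-borders (suc k) (suc n) (s≤s n≤k) {π} π∈ = count , λ c → begin
  rsBeforeEachU c (D π)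
    ≡⟨ cong (rsBeforeEachU c) (D-split s) ⟩
  c ∷ rsBeforeEachU c (DL ++ r ∷ DR)
    ≡⟨ cong (c ∷_) (rsBeforeEachU-++ c DL (r ∷ DR)) ⟩
  c ∷ rsBeforeEachU c DL ++ rsBeforeEachU (suc (c + countR DL)) DR
    ≡⟨ cong (λ l → c ∷ rsBeforeEachU c DL ++ rsBeforeEachU (suc (c + l)) DR) (proj₁ ihL) ⟩
  c ∷ rsBeforeEachU c DL ++ rsBeforeEachU (suc (c + length L)) DR
    ↭⟨ ↭-prep c (↭-++⁺ (proj₂ ihL c) (proj₂ ihR (suc (c + length L)))) ⟩
  c ∷ map (c +_) (borders [] (standardize L))
      ++ map (suc (c + length L) +_) (borders [] (standardize R))
    ≡⟨ cong₂ (λ v w → c ∷ map (c +_) v ++ map (suc (c + length L) +_) w)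
             (borders-standardize L) (borders-standardize R) ⟩
  c ∷ map (c +_) (borders [] L) ++ map (suc (c + length L) +_) (borders [] R)
    ≡⟨ cong₂ (λ d w → d ∷ map (c +_) (borders [] L) ++ w)
             (sym (+-identityʳ c)) (trans (map-cong shifts (borders [] R)) (map-∘ (borders [] R))) ⟩
  c + 0 ∷ map (c +_) (borders [] L) ++ map (c +_) (map (suc (length L) +_) (borders [] R))
    -- The Dyck word opens with the up step of the maximal letter, whereas the border number 0 of
    -- that letter stands after those of `L`.
    ↭⟨ ↭-sym (shift (c + 0) (map (c +_) (borders [] L)) _) ⟩
  map (c +_) (borders [] L) ++ map (c +_) (0 ∷ map (suc (length L) +_) (borders [] R))
    ≡⟨ sym (map-++ (c +_) (borders [] L) _) ⟩
  map (c +_) (borders [] L ++ 0 ∷ map (suc (length L) +_) (borders [] R))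
    ≡⟨ cong (map (c +_)) (sym (borders-split L R L< R<)) ⟩
  map (c +_) (borders [] (L ++ suc n ∷ R))
    ≡⟨ cong (map (c +_) ∘ borders []) (sym π≡) ⟩
  map (c +_) (borders [] π) ∎
  where
  open PermutationReasoning
  s = maximumSplit π∈
  open MaximumSplit s
  DL = D (standardize L)
  DR = D (standardize R)
  lengths≤k = subst (_≤ k) (sym lengths) n≤k
  ihL = D-borders k (length L) (≤-trans (m≤m+n _ (length R)) lengths≤k) (standardize-∈𝒮 L!)
  ihR = D-borders k (length R) (≤-trans (m≤n+m _ (length L)) lengths≤k) (standardize-∈𝒮 R!)
  shifts : ∀ {c} j → suc (c + length L) + j ≡ c + (suc (length L) + j)
  shifts {c} j = trans (cong (_+ j) (sym (+-suc c (length L)))) (+-assoc c (suc (length L)) j)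
  count : countR (D π) ≡ suc n
  count = trans (cong countR (D-split s)) (trans (countR-++ DL (r ∷ DR))
    (trans (cong₂ (λ l m → l + suc m) (proj₁ ihL) (proj₁ ihR))
      (trans (+-suc (length L) (length R)) (cong suc lengths))))

-- The added 0 is the empty bottom row that `Λ` drops: the first letter of `D π` is `u`, with no `r`
-- before it.
0∷Λ↭leftBorders : ∀ {n π} → π ∈𝒮 suc n → 0 ∷ Λ π ↭ map (leftBorder π) [1⋯ suc n ]
0∷Λ↭leftBorders {n} {π} π∈ = begin
  0 ∷ Λ π
    ≡⟨ cong (λ v → 0 ∷ reverse (drop 1 (rsBeforeEachU 0 v))) D≡ ⟩
  0 ∷ reverse (rsBeforeEachU 0 w)
    ↭⟨ ↭-prep 0 (↭-reverse (rsBeforeEachU 0 w)) ⟩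
  0 ∷ rsBeforeEachU 0 w
    ≡⟨ cong (rsBeforeEachU 0) (sym D≡) ⟩
  rsBeforeEachU 0 (D π)
    ↭⟨ proj₂ (D-borders (suc n) (suc n) ≤-refl π∈) 0 ⟩
  map id (borders [] π)
    ≡⟨ map-id (borders [] π) ⟩
  borders [] π
    ≡⟨ sym (leftBorders≡borders π) ⟩
  map (leftBorder π) [1⋯ length π ]
    ≡⟨ cong (λ m → map (leftBorder π) [1⋯ m ]) (length-𝒮 π∈) ⟩
  map (leftBorder π) [1⋯ suc n ] ∎
  where
  open PermutationReasoning
  open MaximumSplit (maximumSplit π∈) using (L; R)
  w = D (standardize L) ++ r ∷ D (standardize R)
  D≡ : D π ≡ u ∷ w
  D≡ = D-split (maximumSplit π∈)

-- Descents and left-to-right maxima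

∈-greater⇒≤leftBorder : ∀ π {i m} → m ∈ [1⋯ i ∸ 1 ] → letter π i < letter π m → m ≤ leftBorder π i
∈-greater⇒≤leftBorder π {i} m∈ πᵢ<πₘ =
  All.lookup (xs≤max 0 _) (∈-filter⁺ (λ m → letter π i <? letter π m) m∈ πᵢ<πₘ)

-- The maximum is the base value 0 or one of the selected positions; being nonzero excludes the
-- base.
leftBorder-greater : ∀ π i → NonZero (leftBorder π i) →
  leftBorder π i ∈ [1⋯ i ∸ 1 ] × letter π i < letter π (leftBorder π i)
leftBorder-greater π i nz with argmax-sel id 0 (filter (λ m → letter π i <? letter π m) [1⋯ i ∸ 1 ])
... | inj₁ ≡0 = contradiction (subst NonZero ≡0 nz) λ ()
... | inj₂ ∈f = ∈-filter⁻ (λ m → letter π i <? letter π m) ∈f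

∈-descents⁺ : ∀ π {k} → 1 ≤ k → k < length π → letter π (suc k) < letter π k → k ∈ descents π
∈-descents⁺ π 1≤k k<n lt =
  ∈-filter⁺ (λ i → letter π (suc i) <? letter π i) (∈-range⁺ 1≤k (<⇒≤pred k<n)) lt

∈-descents⁻ : ∀ π {k} → k ∈ descents π → 1 ≤ k × k < length π × letter π (suc k) < letter π k
∈-descents⁻ π k∈
  with k∈′ , lt ← ∈-filter⁻ (λ i → letter π (suc i) <? letter π i) {xs = [1⋯ length π ∸ 1 ]} k∈
  with 1≤k , k≤ ← ∈-range⁻ k∈′ = 1≤k , bound (length π) 1≤k k≤ , lt
  where
  -- The truncation in `n ∸ 1` does no harm: at `n = 0` it would force `k ≤ 0`.
  bound : ∀ n {k} → 1 ≤ k → k ≤ n ∸ 1 → k < n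
  bound zero    (s≤s _) ()
  bound (suc n) _       k≤n = s≤s k≤n

-- Let k = aᵢ. The letter at k + 1 is πᵢ itself or, by the maximality of k, at most πᵢ; either way
-- it is below the letter at k.
leftBorder-descent : ∀ π {i} → i ∈ [1⋯ length π ] → NonZero (leftBorder π i) → leftBorder π i ∈ descents π
leftBorder-descent π {i@(suc j)} i∈ nz
  with k∈ , πᵢ<πₖ ← leftBorder-greater π i nz
  with 1≤k , k≤j ← ∈-range⁻ k∈ =
  ∈-descents⁺ π 1≤k (≤-trans (s≤s k≤j) (proj₂ (∈-range⁻ i∈))) (≤-trans (s≤s next≤) πᵢ<πₖ)
  where
  k = leftBorder π i
  next≤ : letter π (suc k) ≤ letter π i
  next≤ with k ≟ j
  ... | yes k≡j = ≤-reflexive (cong (letter π ∘ suc) k≡j)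
  ... | no k≢j  = ≮⇒≥ λ lt →
    <-irrefl refl (∈-greater⇒≤leftBorder π {i} (∈-range⁺ (s≤s z≤n) (≤∧≢⇒< k≤j k≢j)) lt)
leftBorder-descent π {zero} i∈ nz with () ← proj₁ (∈-range⁻ i∈)

-- Position k is the last one before k + 1, so it is the border number as soon as its letter is the
-- greater one.
descent-leftBorder : ∀ π {k} → k ∈ descents π → leftBorder π (suc k) ≡ k
descent-leftBorder π {k} k∈ with 1≤k , _ , lt ← ∈-descents⁻ π k∈ =
  max≈v⁺ (∈-filter⁺ G? (∈-range⁺ 1≤k ≤-refl) lt) (All.filter⁺ G? (All.applyUpTo⁺₁ suc k id)) z≤n
  where G? = λ m → letter π (suc k) <? letter π m

nonzero-leftBorders⊆descents : ∀ π → nonzeroParts (map (leftBorder π) [1⋯ length π ]) ⊆ descents π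
nonzero-leftBorders⊆descents π k∈
  with k∈′ , nz ← ∈-filter⁻ nonZero? {xs = map (leftBorder π) [1⋯ length π ]} k∈
  with i , i∈ , refl ← ∈-map⁻ (leftBorder π) k∈′ = leftBorder-descent π i∈ nz

descents⊆nonzero-leftBorders : ∀ π → descents π ⊆ nonzeroParts (map (leftBorder π) [1⋯ length π ])
descents⊆nonzero-leftBorders π {k} k∈ with s≤s _ , k<n , _ ← ∈-descents⁻ π k∈ =
  ∈-filter⁺ nonZero?
    (subst (_∈ map (leftBorder π) [1⋯ length π ]) (descent-leftBorder π k∈)
      (∈-map⁺ (leftBorder π) (∈-range⁺ (s≤s z≤n) k<n))) _

letter-∈ : ∀ π {i} → i < length π → letter π (suc i) ∈ π
letter-∈ (x ∷ π) {zero}  _   = here refl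
letter-∈ (x ∷ π) {suc i} i<n = there (letter-∈ π (s≤s⁻¹ i<n))

letter-distinct : ∀ {π i j} → Unique π → i < j → j < length π → letter π (suc i) ≢ letter π (suc j)
letter-distinct {x ∷ π} {zero}  {suc j} (x∉ ∷ _) _   j<n = All.lookup x∉ (letter-∈ π (s≤s⁻¹ j<n))
letter-distinct {x ∷ π} {suc i} {suc j} (_ ∷ π!) i<j j<n = letter-distinct π! (s≤s⁻¹ i<j) (s≤s⁻¹ j<n)

-- Nonzero border numbers and left-to-right maxima together account for every position once, so the
-- truncated subtraction is exact.
length-nonzero-leftBorders : ∀ {π} → Unique π →
  length (nonzeroParts (map (leftBorder π) [1⋯ length π ])) ≡ length π ∸ lrmax π
length-nonzero-leftBorders {π} π! = begin
  nz                      ≡⟨ sym (m+n∸n≡m nz (lrmax π)) ⟩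
  nz + lrmax π ∸ lrmax π  ≡⟨ cong (_∸ lrmax π) complement ⟩
  length π ∸ lrmax π      ∎
  where
  open ≡-Reasoning
  nz = length (nonzeroParts (map (leftBorder π) [1⋯ length π ]))
  IsLRMax : ℕ → Set
  IsLRMax i = All (λ m → letter π m < letter π i) [1⋯ i ∸ 1 ]
  nonzero⇒¬lrmax : ∀ {i} → i ∈ [1⋯ length π ] → NonZero (leftBorder π i) → ¬ IsLRMax i
  nonzero⇒¬lrmax {i} _ nonzero isMax with k∈ , lt ← leftBorder-greater π i nonzero =
    ≤⇒≯ (<⇒≤ lt) (All.lookup isMax k∈)
  zero⇒lrmax : ∀ {i} → i ∈ [1⋯ length π ] → ¬ NonZero (leftBorder π i) → IsLRMax i
  zero⇒lrmax {i} i∈ isZero with _ , j<n , refl ← ∈-applyUpTo⁻ suc i∈ =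
    -- A greater letter at position `suc m` would make the border number at least `suc m`, hence
    -- nonzero; distinctness of the letters excludes equality.
    All.applyUpTo⁺₁ suc _ λ {m} m<j → ≤∧≢⇒<
      (≮⇒≥ λ lt → isZero (positive (∈-greater⇒≤leftBorder π {i} (∈-range⁺ (s≤s z≤n) m<j) lt)))
      (letter-distinct π! m<j j<n)
    where
    positive : ∀ {m b} → suc m ≤ b → NonZero b
    positive (s≤s _) = _
  complement : nz + lrmax π ≡ length π
  complement = trans
    (length-filter-complement nonZero? (λ i → all? (λ m → letter π m <? letter π i) [1⋯ i ∸ 1 ])
      (leftBorder π) [1⋯ length π ] nonzero⇒¬lrmax zero⇒lrmax)
    (length-applyUpTo suc (length π))

-- The five equalities

sum-nonzeroParts : ∀ xs → sum (nonzeroParts xs) ≡ sum xs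
sum-nonzeroParts []           = refl
sum-nonzeroParts (zero ∷ xs)  = sum-nonzeroParts xs
sum-nonzeroParts (suc x ∷ xs) = cong (suc x +_) (sum-nonzeroParts xs)

-- Zeros in `xs` are harmless because 0 is the base value of the maximum.
largest-mono : ∀ xs ys → nonzeroParts xs ⊆ ys → largest xs ≤ largest ys
largest-mono xs ys sub = max≤v⁺ z≤n (All.tabulate bound)
  where
  bound : ∀ {x} → x ∈ xs → x ≤ largest ys
  bound {zero}  _  = z≤n
  bound {suc x} x∈ = All.lookup (xs≤max 0 ys) (sub (∈-filter⁺ nonZero? x∈ _))

corollary1p5 : ∀ (n : ℕ) → n ≥ 1 → ∀ (π : Word) → π ∈𝒮 n →
    (length (differentParts (nonzeroParts (Λ π))) ≡ des π)
    × (length (nonzeroParts (Λ π)) ≡ n ∸ lrmax π)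
    × (largest (Λ π) ≡ largest (descents π))
    × (sum (differentParts (Λ π)) ≡ maj π)
    × (sum (Λ π) ≡ lbsum π)
corollary1p5 (suc n) _ π π∈ =
    ↭-length differentNonzero↭descents
  , trans (↭-length nonzero↭) (trans (length-nonzero-leftBorders π!) (cong (_∸ lrmax π) |π|))
  , ≤-antisym (largest-mono (Λ π) (descents π) Λ⊆descents) (largest-mono (descents π) (Λ π) λ k∈ →
      let k∈′ , _ = ∈-filter⁻ nonZero? {xs = descents π} k∈
          k∈″ , _ = ∈-filter⁻ nonZero? {xs = Λ π} (descents⊆Λ k∈′)
      in k∈″)
  -- The different parts may include 0, which is never a descent; dropping it leaves the sum
  -- unchanged.
  , trans (sym (sum-nonzeroParts (differentParts (Λ π)))) (sum-↭ nonzeroDifferent↭descents)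
  -- The leading 0 adds nothing: `sum (0 ∷ Λ π)` computes to `sum (Λ π)`.
  , sum-↭ borders↭
  where
  |π| = length-𝒮 π∈
  π! = Unique-𝒮 π∈
  descents! : Unique (descents π)
  descents! = filter⁺ (λ i → letter π (suc i) <? letter π i) (range-! (length π ∸ 1))
  borders↭ : 0 ∷ Λ π ↭ map (leftBorder π) [1⋯ length π ]
  borders↭ = subst (λ m → 0 ∷ Λ π ↭ map (leftBorder π) [1⋯ m ]) (sym |π|) (0∷Λ↭leftBorders π∈)
  nonzero↭ : nonzeroParts (Λ π) ↭ nonzeroParts (map (leftBorder π) [1⋯ length π ])
  -- The filter discards the leading 0 by computation.
  nonzero↭ = filter-↭ nonZero? borders↭
  Λ⊆descents : nonzeroParts (Λ π) ⊆ descents π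
  Λ⊆descents = nonzero-leftBorders⊆descents π ∘ ∈-resp-↭ nonzero↭
  descents⊆Λ : descents π ⊆ nonzeroParts (Λ π)
  descents⊆Λ = ∈-resp-↭ (↭-sym nonzero↭) ∘ descents⊆nonzero-leftBorders π
  differentNonzero↭descents : differentParts (nonzeroParts (Λ π)) ↭ descents π
  differentNonzero↭descents = unique∧same-elements⇒↭ (deduplicate-! _) descents!
    (Λ⊆descents ∘ ∈-deduplicate⁻ _≟_ (nonzeroParts (Λ π)))
    (∈-deduplicate⁺ _≟_ ∘ descents⊆Λ)
  nonzeroDifferent↭descents : nonzeroParts (differentParts (Λ π)) ↭ descents π
  nonzeroDifferent↭descents = unique∧same-elements⇒↭ (filter⁺ nonZero? (deduplicate-! (Λ π))) descents!
    (λ k∈ → let k∈′ , nz = ∈-filter⁻ nonZero? {xs = differentParts (Λ π)} k∈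
            in Λ⊆descents (∈-filter⁺ nonZero? (∈-deduplicate⁻ _≟_ (Λ π) k∈′) nz))
    (λ k∈ → let k∈′ , nz = ∈-filter⁻ nonZero? {xs = Λ π} (descents⊆Λ k∈)
            in ∈-filter⁺ nonZero? (∈-deduplicate⁺ _≟_ k∈′) nz)
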